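{- Let $G$ be a finite graph on $n$ vertices whose admissible augmentation $C(G)$ is the complete graph $K_n$ (that is, any two distinct non-adjacent vertices of $G$ have at least $5$ common neighbors in $G$). Then $G$ satisfies the token graph reconstruction conjecture: for every integer $k$ with $1\le k<n$ and every finite graph $H$, if $F_k(G)\cong F_k(H)$, then $G\cong H$.
   Context: All graphs are finite, simple and undirected; edges are regarded as 2-element subsets of the vertex set, and $N_G(u)$ denotes the set of neighbors of $u$ in $G$. For a graph $G$ and an integer $k$ with $1\le k<|V(G)|$, the $k$-token graph $F_k(G)$ is the graph whose vertices are the $k$-element subsets of $V(G)$, with two such subsets $A,B$ adjacent if and only if their symmetric difference $A\triangle B$ is an edge of $G$ (in particular $|A\triangle B|=2$). In the claim, $H$ ranges over all finite graphs for which $F_k(H)$ is defined (i.e. $k<|V(H)|$), and is not assumed to have the same number of vertices as $G$. A pair $\{u,v\}$ of distinct vertices of $G$ is called admissible if $|N_G(u)\cap N_G(v)|\ge 5$; $A(G)$ denotes the set of all admissible pairs of $G$. The admissible augmentation of $G$ is the graph $C(G)=(V(G),E(G)\cup A(G))$. -}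

module Defs where

open import Data.Bool.Properties using () renaming (_≟_ to _≟ᵇ_)
open import Data.Fin.Base using (Fin)
open import Data.Fin.Properties using (any?) renaming (_≟_ to _≟ᶠ_)
open import Data.Fin.Subset using (Subset; inside; _∈_; _∉_; _∩_; _∪_; _─_; ⁅_⁆; ∣_∣)
open import Data.Fin.Subset.Properties using (∪-comm; ∩-comm; p⊆p∪q; x∈p∪q⁻; x∈⁅x⁆)
open import Data.Nat.Base using (ℕ; _≤_)
open import Data.Nat.Properties using (_≤?_)
open import Data.Product.Base using (Σ-syntax; ∃₂; _×_; _,_; proj₁)
open import Data.Sum.Base using (_⊎_; [_,_]′) renaming (map to ⊎-map)
open import Data.Vec.Base using (tabulate; _∷_; there)
open import Data.Vec.Properties using (≡-dec)
open import Function.Base using (_∘_)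
open import Function.Bundles using (_↔_; _⇔_; Inverse)
open import Relation.Binary.Core using (Rel)
open import Relation.Binary.Definitions using (Symmetric; Irreflexive; Decidable)
open import Relation.Binary.PropositionalEquality.Core
  using (_≡_; _≢_; refl; sym; subst; ≢-sym)
open import Level using (0ℓ)
open import Relation.Nullary.Decidable using (Dec; does; ¬?; _×-dec_; _⊎-dec_)
open import Relation.Nullary.Negation using (¬_)

-- Decidability of adjacency is automatic classically; here it lets the
-- neighbours of a vertex form a `Subset`, whose elements can be counted.
record Graph (V : Set) : Set₁ where
  infix 4 _~_ _~?_
  field
    _~_      : Rel V 0ℓ
    ~-sym    : Symmetric _~_
    ~-irrefl : Irreflexive _≡_ _~_
    _~?_     : Decidable _~_

open Graph

infix 4 _≅_

record _≅_ {V W : Set} (G : Graph V) (H : Graph W) : Set where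
  field
    bijection : V ↔ W
    preserves : ∀ u v → _~_ G u v ⇔ _~_ H (Inverse.to bijection u) (Inverse.to bijection v)

IsComplete : {V : Set} → Graph V → Set
IsComplete G = ∀ u v → u ≢ v → _~_ G u v

FinGraph : ℕ → Set₁
FinGraph n = Graph (Fin n)

private
  variable
    n : ℕ

infixr 6 _△_

_△_ : Subset n → Subset n → Subset n
p △ q = (p ─ q) ∪ (q ─ p)

IsEdge : FinGraph n → Subset n → Set
IsEdge G p = ∃₂ λ u v → _~_ G u v × p ≡ ⁅ u ⁆ ∪ ⁅ v ⁆

KSubset : ℕ → ℕ → Set
KSubset n k = Σ[ p ∈ Subset n ] ∣ p ∣ ≡ k

private
  △-comm : (p q : Subset n) → p △ q ≡ q △ p
  △-comm p q = ∪-comm (p ─ q) (q ─ p)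

  x∉p─p : (x : Fin n) (p : Subset n) → x ∉ p ─ p
  x∉p─p _ (inside ∷ p) (there x∈) = x∉p─p _ p x∈
  x∉p─p _ (_      ∷ p) (there x∈) = x∉p─p _ p x∈

  x∉p△p : (x : Fin n) (p : Subset n) → x ∉ p △ p
  x∉p△p x p = [ x∉p─p x p , x∉p─p x p ]′ ∘ x∈p∪q⁻ (p ─ p) (p ─ p)

  isEdge? : (G : FinGraph n) (p : Subset n) → Dec (IsEdge G p)
  isEdge? G p = any? λ u → any? λ v → _~?_ G u v ×-dec ≡-dec _≟ᵇ_ p (⁅ u ⁆ ∪ ⁅ v ⁆)

  ¬isEdge-p△p : (G : FinGraph n) (p : Subset n) → ¬ IsEdge G (p △ p)
  ¬isEdge-p△p G p (u , v , _ , eq) =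
    x∉p△p u p (subst (u ∈_) (sym eq) (p⊆p∪q ⁅ v ⁆ (x∈⁅x⁆ u)))

tokenGraph : (k : ℕ) → FinGraph n → Graph (KSubset n k)
tokenGraph k G = record
  { _~_      = λ A B → IsEdge G (proj₁ A △ proj₁ B)
  ; ~-sym    = λ {A} {B} → subst (IsEdge G) (△-comm (proj₁ A) (proj₁ B))
  ; ~-irrefl = λ { {A} refl → ¬isEdge-p△p G (proj₁ A) }
  ; _~?_     = λ A B → isEdge? G (proj₁ A △ proj₁ B)
  }

neighbours : FinGraph n → Fin n → Subset n
neighbours G u = tabulate (λ v → does (_~?_ G u v))

Admissible : FinGraph n → Rel (Fin n) 0ℓ
Admissible G u v = u ≢ v × 5 ≤ ∣ neighbours G u ∩ neighbours G v ∣

private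
  admissible-sym : (G : FinGraph n) → Symmetric (Admissible G)
  admissible-sym G {u} {v} (u≢v , 5≤) =
    ≢-sym u≢v , subst (λ p → 5 ≤ ∣ p ∣) (∩-comm (neighbours G u) (neighbours G v)) 5≤

  admissible? : (G : FinGraph n) → Decidable (Admissible G)
  admissible? G u v =
    ¬? (u ≟ᶠ v) ×-dec (5 ≤? ∣ neighbours G u ∩ neighbours G v ∣)

augmentation : FinGraph n → FinGraph n
augmentation G = record
  { _~_      = λ u v → _~_ G u v ⊎ Admissible G u v
  ; ~-sym    = ⊎-map (~-sym G) (admissible-sym G)
  ; ~-irrefl = λ u≡v → [ ~-irrefl G u≡v , (λ adm → proj₁ adm u≡v) ]′
  ; _~?_     = λ u v → _~?_ G u v ⊎-dec admissible? G u v
  }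

{-# OPTIONS --safe #-}

-- Two k-sets are adjacent in the Johnson graph when one arises from the other by moving a
-- single token anywhere.  Distinct non-adjacent k-sets have at most four common Johnson
-- neighbours, while k-sets differing in an admissible pair have at least five common
-- neighbours in the token graph.  So if C(G) is complete, an isomorphism φ of token graphs
-- preserves Johnson adjacency; counting k-sets shows that G and H have equally many
-- vertices, and by finiteness φ also reflects Johnson adjacency.  Automorphisms of the
-- Johnson graph need not be classified: the neighbours of one k-set A form a rook's graph
-- A × Aᶜ, and φ maps it to that of φ A by a map of the rows and a map of the columns,
-- possibly with transposition.  These two maps together relabel the vertices, and every
-- pair of vertices is the symmetric difference of two k-sets among A and its neighbours.
module Submission where

open import Defs
open import Data.Bool.Base using (Bool; true; false; _∨_; _xor_)
open import Data.Bool.Properties using (¬-not; not-injective)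
open import Data.Empty using (⊥-elim)
open import Data.Fin.Base using (Fin; zero; suc; toℕ; combine; join; splitAt; _↑ˡ_; _↑ʳ_)
open import Data.Fin.Permutation using (↔⇒≡)
open import Data.Fin.Properties
  using (_≟_; any?; all?; ¬∀⟶∃¬; pigeonhole; injective⇒≤; combine-injective; suc-injective;
         join-splitAt; +↔⊎; ↑ˡ-injective; ↑ʳ-injective)
open import Data.Fin.Subset using (Subset; ⁅_⁆; _∪_; _∩_; _∈_; ∣_∣; ⊥)
open import Data.Fin.Subset.Properties using (p⊂q⇒∣p∣<∣q∣; ∣⊥∣≡0; x∈p∩q⁻)
open import Data.Nat.Base
  using (ℕ; zero; suc; _+_; _*_; _≤_; _<_; _<′_; ≤′-reflexive; ≤′-step; s≤s; z≤n; s≤s⁻¹)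
open import Data.Nat.Combinatorics using (_C_; nCk+nC[k+1]≡[n+1]C[k+1])
open import Data.Nat.GeneralisedArithmetic using (fold; fold-+)
open import Data.Nat.Properties as ℕ
  using (≡-irrelevant; <-irrefl; <-cmp; n<1+n; m≤n⇒∃[o]m+o≡n; m≤m+n; +-suc; <-≤-trans; m<n+m)
open import Data.Product.Base using (Σ; ∃; ∃₂; _×_; _,_; proj₁; proj₂)
open import Data.Sum.Base using (_⊎_; inj₁; inj₂; [_,_]′)
  renaming (swap to ⊎-swap; map to ⊎-map)
open import Data.Sum.Function.Propositional using (_⊎-↔_)
open import Data.Vec.Base using ([]; _∷_; lookup; replicate; _++_; _[_]≔_)
open import Data.Vec.Properties
  using (lookup-zipWith; lookup∘tabulate; tabulate∘lookup; tabulate-cong; lookup∘update;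
         lookup∘update′; []=⇒lookup; lookup⇒[]=; lookup-++ˡ; lookup-++ʳ; lookup-replicate)
open import Function.Base using (_∘_; id)
open import Function.Bundles using (_↔_; _⇔_; Inverse; mk↔ₛ′; mk⇔; Equivalence)
open import Function.Definitions using (Injective)
open import Function.Properties.Equivalence using () renaming (trans to ⇔-trans; sym to ⇔-sym)
open import Function.Properties.Inverse using (↔-trans; ↔-sym)
open import Relation.Binary.Definitions using (tri<; tri≈; tri>)
open import Relation.Binary.PropositionalEquality
  using (_≡_; _≢_; refl; sym; trans; cong; cong₂; subst; subst₂; ≢-sym)
open import Relation.Nullary.Decidable using (Dec; yes; no; does; dec-true; dec-false)
open import Relation.Nullary.Negation using (¬_; contradiction)

open Graph
open Inverse using (to; from; strictlyInverseʳ)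

private
  variable
    n m k : ℕ

-- Subsets as Boolean vectors.

≢∧≢⇒≡ : {x y z : Bool} → x ≢ y → x ≢ z → y ≡ z
≢∧≢⇒≡ x≢y x≢z = not-injective (trans (sym (¬-not x≢y)) (¬-not x≢z))

≡true∧≡false⇒≢ : {x y : Bool} → x ≡ true → y ≡ false → x ≢ y
≡true∧≡false⇒≢ refl refl ()

lookup-ext : {P Q : Subset n} → (∀ x → lookup P x ≡ lookup Q x) → P ≡ Q
lookup-ext {P = P} {Q} eq =
  trans (sym (tabulate∘lookup P)) (trans (tabulate-cong eq) (tabulate∘lookup Q))

lookup-⊥ : (x : Fin n) → lookup (⊥ {n}) x ≡ false
lookup-⊥ x = lookup-replicate x false

lookup-⁅⁆ : (u x : Fin n) → lookup ⁅ u ⁆ x ≡ does (x ≟ u)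
lookup-⁅⁆ zero    zero    = refl
lookup-⁅⁆ zero    (suc x) = lookup-⊥ x
lookup-⁅⁆ (suc u) zero    = refl
lookup-⁅⁆ (suc u) (suc x) = lookup-⁅⁆ u x

lookup-pair : (u v x : Fin n) → lookup (⁅ u ⁆ ∪ ⁅ v ⁆) x ≡ does (x ≟ u) ∨ does (x ≟ v)
lookup-pair u v x =
  trans (lookup-zipWith _∨_ x ⁅ u ⁆ ⁅ v ⁆) (cong₂ _∨_ (lookup-⁅⁆ u x) (lookup-⁅⁆ v x))

lookup-△ : (P Q : Subset n) (x : Fin n) → lookup (P △ Q) x ≡ lookup P x xor lookup Q x
lookup-△ (true  ∷ P) (true  ∷ Q) zero = refl
lookup-△ (true  ∷ P) (false ∷ Q) zero = refl
lookup-△ (false ∷ P) (true  ∷ Q) zero = refl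
lookup-△ (false ∷ P) (false ∷ Q) zero = refl
lookup-△ (_ ∷ P) (_ ∷ Q) (suc x) = lookup-△ P Q x

xor-false⇒≡ : (x y : Bool) → x xor y ≡ false → x ≡ y
xor-false⇒≡ true  true  _ = refl
xor-false⇒≡ false false _ = refl

xor-true⇒≢ : (x y : Bool) → x xor y ≡ true → x ≢ y
xor-true⇒≢ true  false _ ()
xor-true⇒≢ false true  _ ()

≢⇒xor-true : (x y : Bool) → x ≢ y → x xor y ≡ true
≢⇒xor-true true  true  x≢y = contradiction refl x≢y
≢⇒xor-true true  false _   = refl
≢⇒xor-true false true  _   = refl
≢⇒xor-true false false x≢y = contradiction refl x≢y

≡⇒xor-false : (x y : Bool) → x ≡ y → x xor y ≡ false
≡⇒xor-false true  _ refl = refl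
≡⇒xor-false false _ refl = refl

-- Sets that differ in exactly two points.

-- Pointwise form of `P △ Q ≡ ⁅ a ⁆ ∪ ⁅ b ⁆` for distinct points. It leaves open which set contains
-- which point.
record Differ (P Q : Subset n) (a b : Fin n) : Set where
  constructor differ
  field
    distinct  : a ≢ b
    atˡ       : lookup P a ≢ lookup Q a
    atʳ       : lookup P b ≢ lookup Q b
    elsewhere : ∀ {x} → x ≢ a → x ≢ b → lookup P x ≡ lookup Q x

module _ {P Q : Subset n} {a b : Fin n} where

  differ-flip : Differ P Q a b → Differ P Q b a
  differ-flip (differ d l r e) = differ (≢-sym d) r l (λ x≢b x≢a → e x≢a x≢b)

  differ-sym : Differ P Q a b → Differ Q P a b
  differ-sym (differ d l r e) = differ d (≢-sym l) (≢-sym r) (λ x≢a x≢b → sym (e x≢a x≢b))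

  differ⇒≢ : Differ P Q a b → P ≢ Q
  differ⇒≢ D refl = Differ.atˡ D refl

  differ-support : Differ P Q a b → ∀ {x} → lookup P x ≢ lookup Q x → x ≡ a ⊎ x ≡ b
  differ-support D {x} Px≢Qx with x ≟ a | x ≟ b
  ... | yes x≡a | _       = inj₁ x≡a
  ... | no _    | yes x≡b = inj₂ x≡b
  ... | no x≢a  | no x≢b  = contradiction (Differ.elsewhere D x≢a x≢b) Px≢Qx

-- A bit can be flipped in only one way, and `Q` and `R` both arise from `P` by flipping `a` and
-- `b`.
differ-unique : {P Q R : Subset n} {a b : Fin n} → Differ P Q a b → Differ P R a b → Q ≡ R
differ-unique {a = a} {b} D E = lookup-ext go
  where
  go : ∀ x → _
  go x with x ≟ a | x ≟ b
  ... | yes refl | _        = ≢∧≢⇒≡ (Differ.atˡ D) (Differ.atˡ E)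
  ... | no _     | yes refl = ≢∧≢⇒≡ (Differ.atʳ D) (Differ.atʳ E)
  ... | no x≢a   | no x≢b   = trans (sym (Differ.elsewhere D x≢a x≢b)) (Differ.elsewhere E x≢a x≢b)

-- The two flips at the shared point `b` cancel.
differ-trans : {P Q R : Subset n} {a a′ b : Fin n} → a ≢ a′ →
  Differ P Q a b → Differ P R a′ b → Differ Q R a a′
differ-trans {P = P} {Q} {R} {a} {a′} {b} a≢a′ D E = differ a≢a′
  (λ Qa≡Ra → D.atˡ (trans (E.elsewhere a≢a′ D.distinct) (sym Qa≡Ra)))
  (λ Qa′≡Ra′ → E.atˡ (trans (D.elsewhere (≢-sym a≢a′) E.distinct) Qa′≡Ra′))
  rest
  where
  module D = Differ D
  module E = Differ E
  rest : ∀ {x} → x ≢ a → x ≢ a′ → lookup Q x ≡ lookup R x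
  rest {x} x≢a x≢a′ with x ≟ b
  ... | yes refl = ≢∧≢⇒≡ D.atʳ E.atʳ
  ... | no x≢b   = trans (sym (D.elsewhere x≢a x≢b)) (E.elsewhere x≢a′ x≢b)

differ⇒△ : {P Q : Subset n} {a b : Fin n} → Differ P Q a b → P △ Q ≡ ⁅ a ⁆ ∪ ⁅ b ⁆
differ⇒△ {P = P} {Q} {a} {b} D = lookup-ext λ x →
  trans (lookup-△ P Q x) (trans (go x) (sym (lookup-pair a b x)))
  where
  module D = Differ D
  go : ∀ x → lookup P x xor lookup Q x ≡ does (x ≟ a) ∨ does (x ≟ b)
  go x with x ≟ a | x ≟ b
  ... | yes refl | _        = ≢⇒xor-true _ _ D.atˡ
  ... | no _     | yes refl = ≢⇒xor-true _ _ D.atʳ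
  ... | no x≢a   | no x≢b   = ≡⇒xor-false _ _ (D.elsewhere x≢a x≢b)

△⇒differ : {P Q : Subset n} {a b : Fin n} → a ≢ b → P △ Q ≡ ⁅ a ⁆ ∪ ⁅ b ⁆ → Differ P Q a b
△⇒differ {P = P} {Q} {a} {b} a≢b eq = differ a≢b
  (xor-true⇒≢ _ _ (trans (at a) (cong (_∨ does (a ≟ b)) (dec-true (a ≟ a) refl))))
  (xor-true⇒≢ _ _ (trans (at b)
    (cong₂ _∨_ (dec-false (b ≟ a) (≢-sym a≢b)) (dec-true (b ≟ b) refl))))
  (λ {x} x≢a x≢b → xor-false⇒≡ _ _ (trans (at x)
    (cong₂ _∨_ (dec-false (x ≟ a) x≢a) (dec-false (x ≟ b) x≢b))))
  where
  at : ∀ x → lookup P x xor lookup Q x ≡ does (x ≟ a) ∨ does (x ≟ b)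
  at x = trans (sym (lookup-△ P Q x)) (trans (cong (λ S → lookup S x) eq) (lookup-pair a b x))

isEdge⇒differ : (G : FinGraph n) {P Q : Subset n} → IsEdge G (P △ Q) →
  ∃₂ λ u v → _~_ G u v × Differ P Q u v
isEdge⇒differ G (u , v , u~v , eq) =
  u , v , u~v , △⇒differ (λ u≡v → ~-irrefl G u≡v u~v) eq

-- The endpoints of an edge equal to `P △ Q` lie in the support of the difference and are distinct,
-- so they are `a` and `b` in some order.
differ⇒isEdge⇔~ : (G : FinGraph n) {P Q : Subset n} {a b : Fin n} → Differ P Q a b →
  IsEdge G (P △ Q) ⇔ _~_ G a b
differ⇒isEdge⇔~ G {P} {Q} {a} {b} D = mk⇔ fwd (λ a~b → a , b , a~b , differ⇒△ D)
  where
  fwd : IsEdge G (P △ Q) → _~_ G a b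
  fwd e with isEdge⇒differ G e
  ... | u , v , u~v , E
    with differ-support D (Differ.atˡ E) | differ-support D (Differ.atʳ E)
  ... | inj₁ refl | inj₁ refl = contradiction u~v (~-irrefl G refl)
  ... | inj₁ refl | inj₂ refl = u~v
  ... | inj₂ refl | inj₁ refl = ~-sym G u~v
  ... | inj₂ refl | inj₂ refl = contradiction u~v (~-irrefl G refl)

-- Moving a single token.

record Move (P Q : Subset n) (a b : Fin n) : Set where
  constructor move
  field
    P∋a       : lookup P a ≡ true
    Q∌a       : lookup Q a ≡ false
    P∌b       : lookup P b ≡ false
    Q∋b       : lookup Q b ≡ true
    elsewhere : ∀ {x} → x ≢ a → x ≢ b → lookup P x ≡ lookup Q x

move⇒differ : {P Q : Subset n} {a b : Fin n} → Move P Q a b → Differ P Q a b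
move⇒differ (move pa qa pb qb e) =
  differ (λ { refl → ≡true∧≡false⇒≢ pa pb refl }) (≡true∧≡false⇒≢ pa qa) (≢-sym (≡true∧≡false⇒≢ qb pb)) e

⊈-of-equal-size : (P Q : Subset n) {c : Fin n} → ∣ P ∣ ≡ ∣ Q ∣ →
  (∀ x → lookup P x ≡ true → lookup Q x ≡ true) → lookup Q c ≡ true → lookup P c ≢ false
⊈-of-equal-size P Q {c} |P|≡|Q| P⊆Q Q∋c P∌c = <-irrefl |P|≡|Q| (p⊂q⇒∣p∣<∣q∣ {p = P} {Q}
  ( (λ {x} x∈P → lookup⇒[]= x Q (P⊆Q x ([]=⇒lookup x∈P)))
  , c , lookup⇒[]= c Q Q∋c , λ c∈P → ≡true∧≡false⇒≢ ([]=⇒lookup c∈P) P∌c refl))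

-- If one set contained both points, it would properly contain the other, against equal sizes.
differ⇒move : {P Q : Subset n} {a b : Fin n} → ∣ P ∣ ≡ ∣ Q ∣ →
  Differ P Q a b → Move P Q a b ⊎ Move P Q b a
differ⇒move {P = P} {Q} {a} {b} |P|≡|Q| D
  with lookup P a in Pa | lookup P b in Pb | lookup Q a in Qa | lookup Q b in Qb
... | true  | _     | true  | _     = contradiction (trans Pa (sym Qa)) (Differ.atˡ D)
... | false | _     | false | _     = contradiction (trans Pa (sym Qa)) (Differ.atˡ D)
... | _     | true  | _     | true  = contradiction (trans Pb (sym Qb)) (Differ.atʳ D)
... | _     | false | _     | false = contradiction (trans Pb (sym Qb)) (Differ.atʳ D)
... | true  | false | false | true  = inj₁ (move Pa Qa Pb Qb (Differ.elsewhere D))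
... | false | true  | true  | false =
  inj₂ (move Pb Qb Pa Qa (Differ.elsewhere (differ-flip D)))
... | true  | true  | false | false =
  contradiction Qa (⊈-of-equal-size Q P (sym |P|≡|Q|) Q⊆P Pa)
  where
  Q⊆P : ∀ x → lookup Q x ≡ true → lookup P x ≡ true
  Q⊆P x Qx with x ≟ a | x ≟ b
  ... | yes refl | _        = Pa
  ... | no _     | yes refl = Pb
  ... | no x≢a   | no x≢b   = trans (Differ.elsewhere D x≢a x≢b) Qx
... | false | false | true  | true  =
  contradiction Pa (⊈-of-equal-size P Q |P|≡|Q| P⊆Q Qa)
  where
  P⊆Q : ∀ x → lookup P x ≡ true → lookup Q x ≡ true
  P⊆Q x Px with x ≟ a | x ≟ b
  ... | yes refl | _        = Qa
  ... | no _     | yes refl = Qb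
  ... | no x≢a   | no x≢b   = trans (sym (Differ.elsewhere D x≢a x≢b)) Px

KSubset-≡ : {A B : KSubset n k} → proj₁ A ≡ proj₁ B → A ≡ B
KSubset-≡ {A = P , p} {.P , q} refl = cong (P ,_) (≡-irrelevant p q)

∣insert∣ : (P : Subset n) {b : Fin n} → lookup P b ≡ false → ∣ P [ b ]≔ true ∣ ≡ suc ∣ P ∣
∣insert∣ (false ∷ P) {zero}  _ = refl
∣insert∣ (true  ∷ P) {suc b} P∌b = cong suc (∣insert∣ P P∌b)
∣insert∣ (false ∷ P) {suc b} P∌b = ∣insert∣ P P∌b

∣remove∣ : (P : Subset n) {a : Fin n} → lookup P a ≡ true → suc ∣ P [ a ]≔ false ∣ ≡ ∣ P ∣
∣remove∣ (true  ∷ P) {zero}  _ = refl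
∣remove∣ (true  ∷ P) {suc a} P∋a = cong suc (∣remove∣ P P∋a)
∣remove∣ (false ∷ P) {suc a} P∋a = ∣remove∣ P P∋a

exchange : (A : KSubset n k) {a b : Fin n} → lookup (proj₁ A) a ≡ true → lookup (proj₁ A) b ≡ false →
  Σ (KSubset n k) λ B → Move (proj₁ A) (proj₁ B) a b
exchange (P , |P|≡k) {a} {b} P∋a P∌b =
  (P′ [ b ]≔ true , trans (∣insert∣ P′ P′∌b) (trans (∣remove∣ P P∋a) |P|≡k)) ,
  move P∋a
       (trans (lookup∘update′ a≢b P′ true) (lookup∘update a P false))
       P∌b
       (lookup∘update b P′ true)
       (λ x≢a x≢b → sym (trans (lookup∘update′ x≢b P′ true) (lookup∘update′ x≢a P false)))
  where
  P′ = P [ a ]≔ false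
  a≢b : a ≢ b
  a≢b refl = ≡true∧≡false⇒≢ P∋a P∌b refl
  P′∌b : lookup P′ b ≡ false
  P′∌b = trans (lookup∘update′ (≢-sym a≢b) P false) P∌b

-- Johnson adjacency and its common neighbours.

Johnson : KSubset n k → KSubset n k → Set
Johnson A B = ∃₂ λ a b → Move (proj₁ A) (proj₁ B) a b

differ⇒johnson : (A B : KSubset n k) {a b : Fin n} → Differ (proj₁ A) (proj₁ B) a b → Johnson A B
differ⇒johnson (_ , |A|≡k) (_ , |B|≡k) D with differ⇒move (trans |A|≡k (sym |B|≡k)) D
... | inj₁ M = _ , _ , M
... | inj₂ M = _ , _ , M

johnson-irrefl : {A B : KSubset n k} → Johnson A B → A ≢ B
johnson-irrefl (_ , _ , M) refl = differ⇒≢ (move⇒differ M) refl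

edge⇒johnson : (G : FinGraph n) {A B : KSubset n k} → _~_ (tokenGraph k G) A B → Johnson A B
edge⇒johnson G {A} {B} e with isEdge⇒differ G e
... | _ , _ , _ , D = differ⇒johnson A B D

-- The trace of a path that moves `a` to `b` and then `c` to `d`. The first move starts in `P ∖ Q`,
-- which lies in {a, c}, and ends in `Q ∖ P`, which lies in {b, d}.
record TwoMoves (P Q : Subset n) (a b c d : Fin n) : Set where
  field
    P∋a : lookup P a ≡ true
    Q∌a : lookup Q a ≡ false
    P∌b : lookup P b ≡ false
    Q∋b : lookup Q b ≡ true
    loses : ∀ {x} → lookup P x ≡ true → lookup Q x ≡ false → x ≡ a ⊎ x ≡ c
    gains : ∀ {x} → lookup P x ≡ false → lookup Q x ≡ true → x ≡ b ⊎ x ≡ d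

-- If the second move refills `a` or takes the token from `b`, the two moves merge into one, or
-- cancel if both happen. Otherwise they are independent.
two-moves : (A R B : KSubset n k) {a b c d : Fin n} → A ≢ B →
  Move (proj₁ A) (proj₁ R) a b → Move (proj₁ R) (proj₁ B) c d →
  Johnson A B ⊎ TwoMoves (proj₁ A) (proj₁ B) a b c d
two-moves A R B {a} {b} {c} {d} A≢B M N with a ≟ d | b ≟ c
... | yes refl | yes refl = contradiction
  (KSubset-≡ (differ-unique (differ-sym (move⇒differ M)) (differ-flip (move⇒differ N)))) A≢B
... | yes refl | no b≢c = inj₁ (differ⇒johnson A B
  (differ-trans b≢c (differ-flip (differ-sym (move⇒differ M))) (move⇒differ N)))
... | no a≢d | yes refl = inj₁ (differ⇒johnson A B
  (differ-trans a≢d (differ-sym (move⇒differ M)) (differ-flip (move⇒differ N))))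
... | no a≢d | no b≢c = inj₂ record
  { P∋a = M.P∋a
  ; Q∌a = trans (sym (N.elsewhere a≢c a≢d)) M.Q∌a
  ; P∌b = M.P∌b
  ; Q∋b = trans (sym (N.elsewhere b≢c b≢d)) M.Q∋b
  ; loses = loses
  ; gains = gains
  }
  where
  module M = Move M
  module N = Move N
  a≢c : a ≢ c
  a≢c refl = ≡true∧≡false⇒≢ N.P∋a M.Q∌a refl
  b≢d : b ≢ d
  b≢d refl = ≡true∧≡false⇒≢ M.Q∋b N.P∌b refl
  loses : ∀ {x} → lookup (proj₁ A) x ≡ true → lookup (proj₁ B) x ≡ false → x ≡ a ⊎ x ≡ c
  loses {x} A∋x B∌x with x ≟ a | x ≟ c
  ... | yes x≡a | _       = inj₁ x≡a
  ... | no _    | yes x≡c = inj₂ x≡c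
  ... | no x≢a  | no x≢c  = contradiction
    (trans (M.elsewhere x≢a (λ { refl → ≡true∧≡false⇒≢ A∋x M.P∌b refl }))
           (N.elsewhere x≢c (λ { refl → ≡true∧≡false⇒≢ N.Q∋b B∌x refl })))
    (≡true∧≡false⇒≢ A∋x B∌x)
  gains : ∀ {x} → lookup (proj₁ A) x ≡ false → lookup (proj₁ B) x ≡ true → x ≡ b ⊎ x ≡ d
  gains {x} A∌x B∋x with x ≟ b | x ≟ d
  ... | yes x≡b | _       = inj₁ x≡b
  ... | no _    | yes x≡d = inj₂ x≡d
  ... | no x≢b  | no x≢d  = contradiction
    (trans (M.elsewhere (λ { refl → ≡true∧≡false⇒≢ M.P∋a A∌x refl }) x≢b)
           (N.elsewhere (λ { refl → ≡true∧≡false⇒≢ B∋x N.Q∌a refl }) x≢d))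
    (≢-sym (≡true∧≡false⇒≢ B∋x A∌x))

-- A choice between two candidates is one bit, which allows counting by pigeonhole.
does-≟-injective : {x y c d : Fin n} → x ≡ c ⊎ x ≡ d → y ≡ c ⊎ y ≡ d →
  does (x ≟ c) ≡ does (y ≟ c) → x ≡ y
does-≟-injective {x = x} {y} {c} x∈ y∈ eq with x ≟ c | y ≟ c | x∈ | y∈
... | yes refl | yes refl | _         | _         = refl
... | no x≢c   | _        | inj₁ x≡c  | _         = contradiction x≡c x≢c
... | no _     | no y≢c   | _         | inj₁ y≡c  = contradiction y≡c y≢c
... | no _     | no _     | inj₂ refl | inj₂ refl = refl

bit : Bool → Fin 2
bit true  = zero
bit false = suc zero

bit-injective : {x y : Bool} → bit x ≡ bit y → x ≡ y
bit-injective {true}  {true}  _ = refl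
bit-injective {false} {false} _ = refl

-- If A and B differ by two moves, then a common neighbour of A and B is determined by
-- which of the two tokens leaving A moves first and which of the two places of B it takes.
five-common-johnson : (A B : KSubset n k) → A ≢ B → (R : Fin 5 → KSubset n k) → Injective _≡_ _≡_ R →
  (∀ i → Johnson A (R i)) → (∀ i → Johnson (R i) B) → Johnson A B
five-common-johnson A B A≢B R R-inj A-R R-B
  with pigeonhole (n<1+n 4) code
  where
  first : Fin 5 → _
  first i = proj₁ (A-R i)
  target : Fin 5 → _
  target i = proj₁ (proj₂ (A-R i))
  code : Fin 5 → Fin (2 * 2)
  code i = combine (bit (does (first i ≟ first zero))) (bit (does (target i ≟ target zero)))
... | i , j , i<j , code-i≡code-j
  -- The path through `R zero` supplies the candidate pairs with which the choices at `i` and `j`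
  -- are compared.
  with two-moves A (R zero) B A≢B (proj₂ (proj₂ (A-R zero))) (proj₂ (proj₂ (R-B zero)))
     | two-moves A (R i) B A≢B (proj₂ (proj₂ (A-R i))) (proj₂ (proj₂ (R-B i)))
     | two-moves A (R j) B A≢B (proj₂ (proj₂ (A-R j))) (proj₂ (proj₂ (R-B j)))
... | inj₁ J | _ | _ = J
... | _ | inj₁ J | _ = J
... | _ | _ | inj₁ J = J
... | inj₂ T₀ | inj₂ Tᵢ | inj₂ Tⱼ = contradiction (cong toℕ (R-inj (KSubset-≡ Rᵢ≡Rⱼ))) (ℕ.<⇒≢ i<j)
  where
  module T₀ = TwoMoves T₀
  module Tᵢ = TwoMoves Tᵢ
  module Tⱼ = TwoMoves Tⱼ
  bits = combine-injective _ _ _ _ code-i≡code-j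
  a-eq : proj₁ (A-R j) ≡ proj₁ (A-R i)
  a-eq = sym (does-≟-injective (T₀.loses Tᵢ.P∋a Tᵢ.Q∌a) (T₀.loses Tⱼ.P∋a Tⱼ.Q∌a)
    (bit-injective (proj₁ bits)))
  b-eq : proj₁ (proj₂ (A-R j)) ≡ proj₁ (proj₂ (A-R i))
  b-eq = sym (does-≟-injective (T₀.gains Tᵢ.P∌b Tᵢ.Q∋b) (T₀.gains Tⱼ.P∌b Tⱼ.Q∋b)
    (bit-injective (proj₂ bits)))
  Rᵢ≡Rⱼ : proj₁ (R i) ≡ proj₁ (R j)
  Rᵢ≡Rⱼ = differ-unique (move⇒differ (proj₂ (proj₂ (A-R i))))
    (subst₂ (Differ (proj₁ A) (proj₁ (R j))) a-eq b-eq (move⇒differ (proj₂ (proj₂ (A-R j)))))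

-- Common neighbours in the token graph.

enumerate : {j : ℕ} (P : Subset n) → j ≤ ∣ P ∣ →
  Σ (Fin j → Fin n) λ f → Injective _≡_ _≡_ f × ∀ i → lookup P (f i) ≡ true
enumerate {j = zero} P _ = (λ ()) , (λ { {()} }) , λ ()
enumerate {j = suc j} (false ∷ P) le with enumerate P le
... | f , f-inj , f∈P = suc ∘ f , f-inj ∘ suc-injective , f∈P
enumerate {n = suc n} {j = suc j} (true ∷ P) le with enumerate P (s≤s⁻¹ le)
... | f , f-inj , f∈P = g , g-inj , g∈P
  where
  g : Fin (suc j) → Fin (suc n)
  g zero    = zero
  g (suc i) = suc (f i)
  g-inj : Injective _≡_ _≡_ g
  g-inj {zero}  {zero}  _  = refl
  g-inj {suc _} {suc _} eq = cong suc (f-inj (suc-injective eq))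
  g∈P : ∀ i → lookup (true ∷ P) (g i) ≡ true
  g∈P zero    = refl
  g∈P (suc i) = f∈P i

does-true⇒ : {X : Set} (X? : Dec X) → does X? ≡ true → X
does-true⇒ (yes x) _ = x

common-neighbour : (G : FinGraph n) {u v w : Fin n} →
  lookup (neighbours G u ∩ neighbours G v) w ≡ true → _~_ G u w × _~_ G v w
common-neighbour G {u} {v} {w} w∈ =
  at u (proj₁ w∈∩) , at v (proj₂ w∈∩)
  where
  w∈∩ = x∈p∩q⁻ (neighbours G u) (neighbours G v) (lookup⇒[]= w _ w∈)
  at : ∀ x → w ∈ neighbours G x → _~_ G x w
  at x w∈N = does-true⇒ (_~?_ G x w)
    (trans (sym (lookup∘tabulate (λ y → does (_~?_ G x y)) w)) ([]=⇒lookup w∈N))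

-- A common neighbour w of a and b yields a common neighbour of A and A − a + b:
-- the token moves from a to b through w if w is free, and otherwise the token on w
-- moves to b and is replaced by the token on a.
common-token-neighbours : (G : FinGraph n) (A B : KSubset n k) {a b : Fin n} →
  Move (proj₁ A) (proj₁ B) a b → Admissible G a b →
  Σ (Fin 5 → KSubset n k) λ R → Injective _≡_ _≡_ R ×
    (∀ i → _~_ (tokenGraph k G) A (R i)) × (∀ i → _~_ (tokenGraph k G) (R i) B)
common-token-neighbours {n = n} {k = k} G A@(P , _) B@(Q , _) {a} {b} M (a≢b , 5≤)
  with enumerate (neighbours G a ∩ neighbours G b) 5≤
... | w , w-inj , w∈ =
  (λ i → proj₁ (through i (lookup P (w i)) refl)) ,
  (λ {i} {j} → injective i j) ,
  (λ i → proj₁ (edges i)) , (λ i → proj₂ (edges i))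
  where
  module M = Move M
  a~w : ∀ i → _~_ G a (w i)
  a~w i = proj₁ (common-neighbour G (w∈ i))
  b~w : ∀ i → _~_ G b (w i)
  b~w i = proj₂ (common-neighbour G (w∈ i))
  a≢w : ∀ i → a ≢ w i
  a≢w i eq = ~-irrefl G eq (a~w i)
  b≢w : ∀ i → b ≢ w i
  b≢w i eq = ~-irrefl G eq (b~w i)

  Via : Bool → Fin 5 → KSubset n k → Set
  Via true  i R = Move P (proj₁ R) (w i) b
  Via false i R = Move P (proj₁ R) a (w i)

  through : ∀ i t → lookup P (w i) ≡ t → Σ (KSubset n k) (Via t i)
  through i true  P∋w = exchange A P∋w M.P∌b
  through i false P∌w = exchange A M.P∋a P∌w

  edges-via : ∀ i t R → Via t i R → IsEdge G (P △ proj₁ R) × IsEdge G (proj₁ R △ Q)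
  edges-via i true R V =
    Equivalence.from (differ⇒isEdge⇔~ G (move⇒differ V)) (~-sym G (b~w i)) ,
    Equivalence.from (differ⇒isEdge⇔~ G (differ-trans (≢-sym (a≢w i)) (move⇒differ V) (move⇒differ M)))
      (~-sym G (a~w i))
  edges-via i false R V =
    Equivalence.from (differ⇒isEdge⇔~ G (move⇒differ V)) (a~w i) ,
    Equivalence.from (differ⇒isEdge⇔~ G (differ-trans (≢-sym (b≢w i))
      (differ-flip (move⇒differ V)) (differ-flip (move⇒differ M)))) (~-sym G (b~w i))

  edges : ∀ i → _
  edges i = let R , V = through i (lookup P (w i)) refl in edges-via i _ R V

  -- A set of the first kind contains `b`, one of the second kind does not.
  clash : ∀ i j R S → Via true i R → Via false j S → R ≢ S
  clash i j R .R V W refl =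
    ≡true∧≡false⇒≢ (Move.Q∋b V) (trans (sym (Move.elsewhere W (≢-sym a≢b) (b≢w j))) M.P∌b) refl

  -- Two sets of the same kind come from moves sharing an endpoint, so distinct `w i` and `w j`
  -- would make them differ.
  separate : ∀ i j s t R S → Via s i R → Via t j S → R ≡ S → w i ≡ w j
  separate i j true  false R S  V W eq = contradiction eq (clash i j R S V W)
  separate i j false true  R S  V W eq = contradiction (sym eq) (clash j i S R W V)
  separate i j true  true  R .R V W refl with w i ≟ w j
  ... | yes eq = eq
  ... | no  ≢w = contradiction refl (differ⇒≢ (differ-trans ≢w (move⇒differ V) (move⇒differ W)))
  separate i j false false R .R V W refl with w i ≟ w j
  ... | yes eq = eq
  ... | no  ≢w = contradiction refl
    (differ⇒≢ (differ-trans ≢w (differ-flip (move⇒differ V)) (differ-flip (move⇒differ W))))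

  injective : ∀ i j → _ ≡ _ → i ≡ j
  injective i j eq =
    let R , V = through i (lookup P (w i)) refl
        S , W = through j (lookup P (w j)) refl
    in w-inj (separate i j _ _ R S V W eq)

-- Token graph isomorphisms preserve Johnson adjacency.

↔-injective : {A B : Set} (e : A ↔ B) → Injective _≡_ _≡_ (to e)
↔-injective e {x} {y} eq =
  trans (sym (strictlyInverseʳ e x)) (trans (cong (from e) eq) (strictlyInverseʳ e y))

module _ (G : FinGraph n) (complete : IsComplete (augmentation G)) (H : FinGraph m)
         (iso : tokenGraph k G ≅ tokenGraph k H) where

  open _≅_ iso using (bijection; preserves)

  private
    f : KSubset n k → KSubset m k
    f = to bijection

  -- The two endpoints of the move are adjacent in `G` or admissible. In the first case `A` and `B`
  -- are adjacent in the token graph. In the second, their five common neighbours are mapped to five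
  -- common Johnson neighbours of the images.
  johnson-preserved : ∀ A B → Johnson A B → Johnson (f A) (f B)
  johnson-preserved A B J@(a , b , M) with complete a b (Differ.distinct (move⇒differ M))
  ... | inj₁ a~b = edge⇒johnson H {f A} {f B} (Equivalence.to (preserves A B)
    (Equivalence.from (differ⇒isEdge⇔~ G (move⇒differ M)) a~b))
  ... | inj₂ adm with common-token-neighbours G A B M adm
  ... | R , R-inj , A~R , R~B = five-common-johnson (f A) (f B)
    (johnson-irrefl J ∘ ↔-injective bijection) (f ∘ R) (R-inj ∘ ↔-injective bijection)
    (λ i → edge⇒johnson H {f A} {f (R i)} (Equivalence.to (preserves A (R i)) (A~R i)))
    (λ i → edge⇒johnson H {f (R i)} {f B} (Equivalence.to (preserves (R i) B) (R~B i)))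

-- Counting k-sets.

-- Pascal's rule as a bijection.
KSubset-∷ : KSubset (suc n) (suc k) ↔ (KSubset n k ⊎ KSubset n (suc k))
KSubset-∷ {n} {k} = mk↔ₛ′ split cons split-cons cons-split
  where
  split : KSubset (suc n) (suc k) → KSubset n k ⊎ KSubset n (suc k)
  split (true  ∷ P , eq) = inj₁ (P , ℕ.suc-injective eq)
  split (false ∷ P , eq) = inj₂ (P , eq)
  cons : KSubset n k ⊎ KSubset n (suc k) → KSubset (suc n) (suc k)
  cons (inj₁ (P , eq)) = true ∷ P , cong suc eq
  cons (inj₂ (P , eq)) = false ∷ P , eq
  split-cons : ∀ x → split (cons x) ≡ x
  split-cons (inj₁ _) = cong inj₁ (KSubset-≡ refl)
  split-cons (inj₂ _) = refl
  cons-split : ∀ x → cons (split x) ≡ x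
  cons-split (true  ∷ P , _) = KSubset-≡ refl
  cons-split (false ∷ P , _) = refl

KSubset-zero : KSubset n 0 ↔ Fin 1
KSubset-zero {n} = mk↔ₛ′ (λ _ → zero) (λ _ → ⊥ , ∣⊥∣≡0 n) (λ { zero → refl })
  (λ (P , eq) → KSubset-≡ (sym (∣p∣≡0⇒p≡⊥ P eq)))
  where
  ∣p∣≡0⇒p≡⊥ : ∀ {n} (P : Subset n) → ∣ P ∣ ≡ 0 → P ≡ ⊥
  ∣p∣≡0⇒p≡⊥ []          _  = refl
  ∣p∣≡0⇒p≡⊥ (false ∷ P) eq = cong (false ∷_) (∣p∣≡0⇒p≡⊥ P eq)

KSubset↔Fin : ∀ n k → KSubset n k ↔ Fin (n C k)
KSubset↔Fin n       zero    = KSubset-zero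
KSubset↔Fin zero    (suc k) = mk↔ₛ′ (λ { ([] , ()) }) (λ ()) (λ ()) (λ { ([] , ()) })
KSubset↔Fin (suc n) (suc k) = subst (λ N → KSubset (suc n) (suc k) ↔ Fin N)
  (nCk+nC[k+1]≡[n+1]C[k+1] n k)
  (↔-trans KSubset-∷ (↔-trans (KSubset↔Fin n k ⊎-↔ KSubset↔Fin n (suc k)) (↔-sym +↔⊎)))

0<nCk : ∀ {n k} → k ≤ n → 0 < n C k
0<nCk {k = zero} _ = s≤s z≤n
0<nCk {suc n} {suc k} (s≤s k≤n) =
  subst (0 <_) (nCk+nC[k+1]≡[n+1]C[k+1] n k) (<-≤-trans (0<nCk k≤n) (m≤m+n _ _))

nC[1+k]<[1+n]C[1+k] : ∀ {n k} → k ≤ n → n C suc k < suc n C suc k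
nC[1+k]<[1+n]C[1+k] {n} {k} k≤n =
  subst (n C suc k <_) (nCk+nC[k+1]≡[n+1]C[k+1] n k) (m<n+m _ (0<nCk k≤n))

-- Passing from `n` to `suc n` adds `n C k`, which is positive for `k ≤ n`. The lower index is a
-- successor because `n C 0` is constant.
C-strictMono : ∀ {n m k} → k ≤ n → n <′ m → n C suc k < m C suc k
C-strictMono k≤n (≤′-reflexive refl) = nC[1+k]<[1+n]C[1+k] k≤n
C-strictMono k≤n (≤′-step n<m) =
  ℕ.<-trans (C-strictMono k≤n n<m) (nC[1+k]<[1+n]C[1+k] (ℕ.≤-trans k≤n (ℕ.<⇒≤ (ℕ.<′⇒< n<m))))

KSubset↔⇒≡ : suc k ≤ n → suc k ≤ m → KSubset n (suc k) ↔ KSubset m (suc k) → n ≡ m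
KSubset↔⇒≡ {k} {n} {m} k<n k<m e with <-cmp n m
... | tri≈ _ n≡m _ = n≡m
... | tri< n<m _ _ = contradiction C≡C (ℕ.<⇒≢ (C-strictMono (ℕ.<⇒≤ k<n) (ℕ.<⇒<′ n<m)))
  where
  C≡C : n C suc k ≡ m C suc k
  C≡C = ↔⇒≡ (↔-trans (↔-sym (KSubset↔Fin n (suc k))) (↔-trans e (KSubset↔Fin m (suc k))))
... | tri> _ _ m<n = contradiction C≡C (ℕ.<⇒≢ (C-strictMono (ℕ.<⇒≤ k<m) (ℕ.<⇒<′ m<n)))
  where
  C≡C : m C suc k ≡ n C suc k
  C≡C = sym (↔⇒≡ (↔-trans (↔-sym (KSubset↔Fin n (suc k))) (↔-trans e (KSubset↔Fin m (suc k)))))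

-- Injective self-maps of finite sets reflect preserved relations.

-- The f-orbit of (x , y) is finite, so it returns to (x , y), which is thus a later
-- point of the orbit of (f x , f y).
finite-reflects : {A : Set} {N : ℕ} (e : A ↔ Fin N) {f : A → A} → Injective _≡_ _≡_ f →
  (R : A → A → Set) → (∀ x y → R x y → R (f x) (f y)) → ∀ x y → R (f x) (f y) → R x y
finite-reflects {A} {N} e {f} f-inj R f-pres x y Rfxfy
  -- Both orbits are encoded together, so that one period serves `x` and `y`.
  with pigeonhole (n<1+n (N * N)) (λ i → combine (to e (fold x f (toℕ i))) (to e (fold y f (toℕ i))))
-- As `i<j` is a bound on the successor of `toℕ i`, the period is `suc d`, and `along` can start at
-- `f x` and `f y`.
... | i , j , i<j , eq with m≤n⇒∃[o]m+o≡n i<j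
... | d , i+d≡j = subst₂ R (returns x (proj₁ both)) (returns y (proj₂ both)) (along d)
  where
  both = combine-injective _ _ _ _ eq

  fold-injective : ∀ a {b c} → fold b f a ≡ fold c f a → b ≡ c
  fold-injective zero    eq = eq
  fold-injective (suc a) eq = fold-injective a (f-inj eq)

  returns : ∀ z → to e (fold z f (toℕ i)) ≡ to e (fold z f (toℕ j)) → fold z f (suc d) ≡ z
  returns z eq = sym (fold-injective (toℕ i) (trans (↔-injective e eq)
    (trans (cong (fold z f) (trans (sym i+d≡j) (sym (+-suc (toℕ i) d)))) (fold-+ z f (toℕ i)))))

  along : ∀ d → R (fold x f (suc d)) (fold y f (suc d))
  along zero    = Rfxfy
  along (suc d) = f-pres _ _ (along d)

-- Collinearity-preserving maps of a grid.

module Grid {k l n : ℕ} (x₀ : Fin k) (y₀ : Fin l) where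

  Coordinate : Set
  Coordinate = Fin k → Fin l → Fin n

  -- Here `p` and `q` are the two coordinates of one map between grids, and the relation is lying on
  -- a common row or column.
  Preserves Reflects : Coordinate → Coordinate → Set
  Preserves p q = ∀ x y x′ y′ → x ≡ x′ ⊎ y ≡ y′ → p x y ≡ p x′ y′ ⊎ q x y ≡ q x′ y′
  Reflects  p q = ∀ x y x′ y′ → p x y ≡ p x′ y′ ⊎ q x y ≡ q x′ y′ → x ≡ x′ ⊎ y ≡ y′

  IsProduct : Coordinate → Coordinate → Set
  IsProduct p q = ∀ x y → p x y ≡ p x y₀ × q x y ≡ q x₀ y

  -- If `g` takes different values at `z₀` and `z₁`, then `h` agrees there, and any `z` must share
  -- its `h`-value with one of the two.
  line : ∀ {j} (g h : Fin j → Fin n) (z₀ : Fin j) → (∀ z z′ → g z ≡ g z′ ⊎ h z ≡ h z′) →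
    (∀ z → g z ≡ g z₀) ⊎ (∀ z → h z ≡ h z₀)
  line g h z₀ collinear with all? (λ z → g z ≟ g z₀)
  ... | yes g-const = inj₁ g-const
  ... | no ¬g-const with ¬∀⟶∃¬ _ _ (λ z → g z ≟ g z₀) ¬g-const
  ... | z₁ , gz₁≢gz₀ = inj₂ go
    where
    hz₁≡hz₀ : h z₁ ≡ h z₀
    hz₁≡hz₀ = [ (λ eq → contradiction eq gz₁≢gz₀) , id ]′ (collinear z₁ z₀)
    go : ∀ z → h z ≡ h z₀
    go z with collinear z z₀ | collinear z z₁
    ... | inj₂ eq | _       = eq
    ... | inj₁ _  | inj₂ eq = trans eq hz₁≡hz₀
    ... | inj₁ e₀ | inj₁ e₁ = contradiction (trans (sym e₁) e₀) gz₁≢gz₀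

  -- A cell off both base lines is not collinear with the base cell, so neither is its image. This
  -- excludes the wrong alternative when the cell is compared with its projections to the base
  -- lines.
  cross⇒product : ∀ p q → Preserves p q → Reflects p q →
    (∀ y → p x₀ y ≡ p x₀ y₀) → (∀ x → q x y₀ ≡ q x₀ y₀) → IsProduct p q
  cross⇒product p q pres reflects row column x y with x ≟ x₀ | y ≟ y₀
  ... | yes refl | _        = row y , refl
  ... | no _     | yes refl = refl , column x
  ... | no x≢x₀  | no y≢y₀  =
    [ id , (λ eq → ⊥-elim (apart (inj₂ (trans eq (column x))))) ]′ (pres x y x y₀ (inj₁ refl)) ,
    [ (λ eq → ⊥-elim (apart (inj₁ (trans eq (row y))))) , id ]′ (pres x y x₀ y (inj₂ refl))
    where
    apart : ¬ (p x y ≡ p x₀ y₀ ⊎ q x y ≡ q x₀ y₀)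
    apart = [ x≢x₀ , y≢y₀ ]′ ∘ reflects x y x₀ y₀

  -- Only possible when the grid is a single row or column.
  same-lines⇒product : ∀ p q → Preserves p q → Reflects p q →
    (∀ y → p x₀ y ≡ p x₀ y₀) → (∀ x → p x y₀ ≡ p x₀ y₀) → IsProduct p q ⊎ IsProduct q p
  same-lines⇒product p q pres reflects row column with all? (λ y → y ≟ y₀)
  ... | yes y≡y₀ = inj₂ (cross⇒product q p
    (λ x y x′ y′ → ⊎-swap ∘ pres x y x′ y′) (λ x y x′ y′ → reflects x y x′ y′ ∘ ⊎-swap)
    (λ y → cong (q x₀) (y≡y₀ y)) column)
  ... | no ¬y≡y₀ with ¬∀⟶∃¬ _ _ (λ y → y ≟ y₀) ¬y≡y₀
  ... | y₁ , y₁≢y₀ = inj₁ (cross⇒product p q pres reflects row λ x → cong (λ x → q x y₀) (x≡x₀ x))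
    where
    x≡x₀ : ∀ x → x ≡ x₀
    x≡x₀ x = [ id , (λ eq → contradiction (sym eq) y₁≢y₀) ]′
      (reflects x y₀ x₀ y₁ (inj₁ (trans (column x) (sym (row y₁)))))

  -- The base row and the base column each map into a line. Perpendicular lines give a product or
  -- its transpose, and parallel lines the degenerate case.
  product-or-transpose : ∀ p q → Preserves p q → Reflects p q → IsProduct p q ⊎ IsProduct q p
  product-or-transpose p q pres reflects
    with line (p x₀) (q x₀) y₀ (λ y y′ → pres x₀ y x₀ y′ (inj₁ refl))
       | line (λ x → p x y₀) (λ x → q x y₀) x₀ (λ x x′ → pres x y₀ x′ y₀ (inj₂ refl))
  ... | inj₁ row | inj₂ column = inj₁ (cross⇒product p q pres reflects row column)
  ... | inj₁ row | inj₁ column = same-lines⇒product p q pres reflects row column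
  ... | inj₂ row | inj₁ column = inj₂ (cross⇒product q p
    (λ x y x′ y′ → ⊎-swap ∘ pres x y x′ y′) (λ x y x′ y′ → reflects x y x′ y′ ∘ ⊎-swap) row column)
  ... | inj₂ row | inj₂ column = ⊎-swap (same-lines⇒product q p
    (λ x y x′ y′ → ⊎-swap ∘ pres x y x′ y′) (λ x y x′ y′ → reflects x y x′ y′ ∘ ⊎-swap) row column)

-- Finite injections, and collinearity around a k-set.

injective⇒surjective : {f : Fin n → Fin n} → Injective _≡_ _≡_ f → ∀ j → ∃ λ i → f i ≡ j
injective⇒surjective {n} {f} f-inj j with any? (λ i → f i ≟ j)
... | yes hit    = hit
... | no  missed = contradiction (injective⇒≤ (λ {x} {y} → g-inj {x} {y})) ℕ.1+n≰n
  where
  g : Fin (suc n) → Fin n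
  g zero    = j
  g (suc i) = f i
  g-inj : Injective _≡_ _≡_ g
  g-inj {zero}  {zero}  _  = refl
  g-inj {zero}  {suc i} eq = contradiction (i , sym eq) missed
  g-inj {suc i} {zero}  eq = contradiction (i , eq) missed
  g-inj {suc _} {suc _} eq = cong suc (f-inj eq)

injective⇒↔ : (f : Fin n → Fin n) → Injective _≡_ _≡_ f → Fin n ↔ Fin n
injective⇒↔ f f-inj =
  mk↔ₛ′ f (proj₁ ∘ f-sur) (proj₂ ∘ f-sur) (λ i → f-inj (proj₂ (f-sur (f i))))
  where
  f-sur = injective⇒surjective f-inj

gains⇒target : {P Q : Subset n} {a b : Fin n} → Move P Q a b →
  ∀ {x} → lookup P x ≡ false → lookup Q x ≡ true → x ≡ b
gains⇒target M P∌x Q∋x with differ-support (move⇒differ M) (≢-sym (≡true∧≡false⇒≢ Q∋x P∌x))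
... | inj₁ refl = contradiction refl (≡true∧≡false⇒≢ (Move.P∋a M) P∌x)
... | inj₂ x≡b  = x≡b

-- The neighbourhood of Z in the Johnson graph is a rook's graph, with a row for each
-- token of Z and a column for each free vertex.
module _ (Z A B : KSubset n k) {a b a′ b′ : Fin n}
         (M : Move (proj₁ Z) (proj₁ A) a b) (N : Move (proj₁ Z) (proj₁ B) a′ b′) where

  private
    module M = Move M
    module N = Move N

  -- If both coordinates differed, `B` would gain the distinct points `a` and `b′` over `A`, but a
  -- single move gains only one.
  collinear⇒ : A ≡ B ⊎ Johnson A B → a ≡ a′ ⊎ b ≡ b′
  collinear⇒ J with a ≟ a′ | b ≟ b′
  ... | yes a≡a′ | _        = inj₁ a≡a′
  ... | no _     | yes b≡b′ = inj₂ b≡b′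
  ... | no a≢a′  | no b≢b′  = contradiction J
    [ (λ { refl → ≡true∧≡false⇒≢ B∋a M.Q∌a refl })
    , (λ (_ , _ , L) → a≢b′ (trans (gains⇒target L M.Q∌a B∋a) (sym (gains⇒target L A∌b′ N.Q∋b)))) ]′
    where
    a≢b′ : a ≢ b′
    a≢b′ refl = ≡true∧≡false⇒≢ M.P∋a N.P∌b refl
    B∋a : lookup (proj₁ B) a ≡ true
    B∋a = trans (sym (N.elsewhere a≢a′ a≢b′)) M.P∋a
    A∌b′ : lookup (proj₁ A) b′ ≡ false
    A∌b′ = trans (sym (M.elsewhere (≢-sym a≢b′) (≢-sym b≢b′))) N.P∌b

  ⇒collinear : a ≡ a′ ⊎ b ≡ b′ → A ≡ B ⊎ Johnson A B
  ⇒collinear eq with a ≟ a′ | b ≟ b′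
  ... | yes refl | yes refl = inj₁ (KSubset-≡ (differ-unique (move⇒differ M) (move⇒differ N)))
  ... | yes refl | no b≢b′  = inj₂ (differ⇒johnson A B
    (differ-trans b≢b′ (differ-flip (move⇒differ M)) (differ-flip (move⇒differ N))))
  ... | no a≢a′  | yes refl = inj₂ (differ⇒johnson A B
    (differ-trans a≢a′ (move⇒differ M) (move⇒differ N)))
  ... | no a≢a′  | no b≢b′  = contradiction eq [ a≢a′ , b≢b′ ]′

-- Relabelling the vertices.

module Reconstruction {k l : ℕ} (x₀ : Fin k) (y₀ : Fin l) (G H : FinGraph (k + l))
  (complete : IsComplete (augmentation G)) (iso : tokenGraph k G ≅ tokenGraph k H) where

  open _≅_ iso using (bijection; preserves)

  f : KSubset (k + l) k → KSubset (k + l) k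
  f = to bijection

  f-injective : Injective _≡_ _≡_ f
  f-injective = ↔-injective bijection

  f-johnson : ∀ A B → Johnson A B → Johnson (f A) (f B)
  f-johnson = johnson-preserved G complete H iso

  f-johnson⁻ : ∀ A B → Johnson (f A) (f B) → Johnson A B
  f-johnson⁻ = finite-reflects (KSubset↔Fin (k + l) k) f-injective Johnson f-johnson

  -- With the first `k` vertices as centre, `splitAt k` separates row indices from column indices.
  base : KSubset (k + l) k
  base = replicate k true ++ replicate l false , size k
    where
    size : ∀ k → ∣ replicate k true ++ replicate l false ∣ ≡ k
    size zero    = ∣⊥∣≡0 l
    size (suc k) = cong suc (size k)

  base∋ : ∀ x → lookup (proj₁ base) (x ↑ˡ l) ≡ true
  base∋ x = trans (lookup-++ˡ (replicate k true) (replicate l false) x) (lookup-replicate x true)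

  base∌ : ∀ y → lookup (proj₁ base) (k ↑ʳ y) ≡ false
  base∌ y = trans (lookup-++ʳ (replicate k true) (replicate l false) y) (lookup-replicate y false)

  cell : Fin k → Fin l → KSubset (k + l) k
  cell x y = proj₁ (exchange base (base∋ x) (base∌ y))

  cell-move : ∀ x y → Move (proj₁ base) (proj₁ (cell x y)) (x ↑ˡ l) (k ↑ʳ y)
  cell-move x y = proj₂ (exchange base (base∋ x) (base∌ y))

  image-johnson : ∀ x y → Johnson (f base) (f (cell x y))
  image-johnson x y = f-johnson base (cell x y) (_ , _ , cell-move x y)

  p q : Fin k → Fin l → Fin (k + l)
  p x y = proj₁ (image-johnson x y)
  q x y = proj₁ (proj₂ (image-johnson x y))

  image-move : ∀ x y → Move (proj₁ (f base)) (proj₁ (f (cell x y))) (p x y) (q x y)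
  image-move x y = proj₂ (proj₂ (image-johnson x y))

  open Grid {k} {l} {k + l} x₀ y₀

  preserves-collinear : Preserves p q
  preserves-collinear x y x′ y′ eq =
    collinear⇒ (f base) _ _ (image-move x y) (image-move x′ y′)
      (⊎-map (cong f) (f-johnson _ _)
        (⇒collinear base _ _ (cell-move x y) (cell-move x′ y′)
          (⊎-map (cong (_↑ˡ l)) (cong (k ↑ʳ_)) eq)))

  reflects-collinear : Reflects p q
  reflects-collinear x y x′ y′ eq =
    ⊎-map (↑ˡ-injective l x x′) (↑ʳ-injective k y y′)
      (collinear⇒ base _ _ (cell-move x y) (cell-move x′ y′)
        (⊎-map f-injective (f-johnson⁻ _ _)
          (⇒collinear (f base) _ _ (image-move x y) (image-move x′ y′) eq)))

  -- The transposed case, which arises from complementation when k ≡ l, needs no separate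
  -- treatment since Differ does not see the order of its endpoints.
  relabelling : Σ (Fin k → Fin (k + l)) λ σ → Σ (Fin l → Fin (k + l)) λ τ →
    ∀ x y → Differ (proj₁ (f base)) (proj₁ (f (cell x y))) (σ x) (τ y)
  relabelling = [ straight , transposed ]′
    (product-or-transpose p q preserves-collinear reflects-collinear)
    where
    straight : IsProduct p q → _
    straight prod = (λ x → p x y₀) , (λ y → q x₀ y) , λ x y →
      subst₂ (Differ _ _) (proj₁ (prod x y)) (proj₂ (prod x y)) (move⇒differ (image-move x y))
    transposed : IsProduct q p → _
    transposed prod = (λ x → q x y₀) , (λ y → p x₀ y) , λ x y →
      subst₂ (Differ _ _) (proj₁ (prod x y)) (proj₂ (prod x y))
        (differ-flip (move⇒differ (image-move x y)))

  module Relabelled (σ : Fin k → Fin (k + l)) (τ : Fin l → Fin (k + l))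
    (image-differ : ∀ x y → Differ (proj₁ (f base)) (proj₁ (f (cell x y))) (σ x) (τ y)) where

    f-≢ : ∀ A B → proj₁ A ≢ proj₁ B → proj₁ (f A) ≢ proj₁ (f B)
    f-≢ A B A≢B eq = A≢B (cong proj₁ (f-injective (KSubset-≡ eq)))

    -- Such `A` and `B` turn adjacency of `u` and `v` into token adjacency, which `f` carries over
    -- to `u′` and `v′`. They also show `u′ ≢ v′`.
    Realised : (u v u′ v′ : Fin (k + l)) → Set
    Realised u v u′ v′ = ∃₂ λ A B →
      Differ (proj₁ A) (proj₁ B) u v × Differ (proj₁ (f A)) (proj₁ (f B)) u′ v′

    -- A token and a free vertex are realised by `base` and their cell, two tokens by cells of
    -- column `y₀`, two free vertices by cells of row `x₀`.
    realised : ∀ z z′ → z ≢ z′ → Realised (join k l z) (join k l z′) ([ σ , τ ]′ z) ([ σ , τ ]′ z′)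
    realised (inj₁ x) (inj₂ y) _ = base , cell x y , move⇒differ (cell-move x y) , image-differ x y
    realised (inj₂ y) (inj₁ x) _ =
      base , cell x y , differ-flip (move⇒differ (cell-move x y)) , differ-flip (image-differ x y)
    realised (inj₁ x) (inj₁ x′) z≢z′ = cell x y₀ , cell x′ y₀ , D , differ-trans
      -- If `σ` identified the two tokens, both cells would have the same image, against injectivity
      -- of `f`.
      (λ eq → f-≢ (cell x y₀) (cell x′ y₀) (differ⇒≢ D) (differ-unique (image-differ x y₀)
        (subst (λ u → Differ _ _ u (τ y₀)) (sym eq) (image-differ x′ y₀))))
      (image-differ x y₀) (image-differ x′ y₀)
      where
      D = differ-trans (λ eq → z≢z′ (cong inj₁ (↑ˡ-injective l x x′ eq)))
        (move⇒differ (cell-move x y₀)) (move⇒differ (cell-move x′ y₀))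
    realised (inj₂ y) (inj₂ y′) z≢z′ = cell x₀ y , cell x₀ y′ , D , differ-trans
      (λ eq → f-≢ (cell x₀ y) (cell x₀ y′) (differ⇒≢ D) (differ-unique (image-differ x₀ y)
        (subst (Differ _ _ (σ x₀)) (sym eq) (image-differ x₀ y′))))
      (differ-flip (image-differ x₀ y)) (differ-flip (image-differ x₀ y′))
      where
      D = differ-trans (λ eq → z≢z′ (cong inj₂ (↑ʳ-injective k y y′ eq)))
        (differ-flip (move⇒differ (cell-move x₀ y))) (differ-flip (move⇒differ (cell-move x₀ y′)))

    s : Fin (k + l) → Fin (k + l)
    s u = [ σ , τ ]′ (splitAt k u)

    realised-by-s : ∀ u v → u ≢ v → Realised u v (s u) (s v)
    realised-by-s u v u≢v = subst₂ (λ u′ v′ → Realised u′ v′ (s u) (s v))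
      (join-splitAt k l u) (join-splitAt k l v)
      (realised (splitAt k u) (splitAt k v) λ eq →
        u≢v (trans (sym (join-splitAt k l u)) (trans (cong (join k l) eq) (join-splitAt k l v))))

    s-injective : Injective _≡_ _≡_ s
    s-injective {u} {v} eq with u ≟ v
    ... | yes u≡v = u≡v
    ... | no  u≢v = contradiction eq (Differ.distinct (proj₂ (proj₂ (proj₂ (realised-by-s u v u≢v)))))

    s-preserves : ∀ u v → _~_ G u v ⇔ _~_ H (s u) (s v)
    s-preserves u v with u ≟ v
    ... | yes refl = mk⇔ (⊥-elim ∘ ~-irrefl G refl) (⊥-elim ∘ ~-irrefl H refl)
    ... | no u≢v   = let A , B , D , E = realised-by-s u v u≢v in
      ⇔-trans (⇔-sym (differ⇒isEdge⇔~ G D)) (⇔-trans (preserves A B) (differ⇒isEdge⇔~ H E))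

    reconstructed : G ≅ H
    reconstructed = record { bijection = injective⇒↔ s s-injective ; preserves = s-preserves }

  reconstructed : G ≅ H
  reconstructed = let σ , τ , image-differ = relabelling in Relabelled.reconstructed σ τ image-differ

theorem2 : (n : ℕ) (G : FinGraph n) → IsComplete (augmentation G) →
    (k : ℕ) → 1 ≤ k → k < n →
    (m : ℕ) (H : FinGraph m) → k < m →
    tokenGraph k G ≅ tokenGraph k H → G ≅ H
theorem2 n G complete (suc k) 1≤k k<n m H k<m iso
  with refl ← KSubset↔⇒≡ (ℕ.<⇒≤ k<n) (ℕ.<⇒≤ k<m) (_≅_.bijection iso)
  with l , k+l≡n ← m≤n⇒∃[o]m+o≡n k<n
  -- Now `n` is `suc k + suc l`, so the grid has a row and a column, and `zero` can index the base
  -- of each.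
  with refl ← trans (+-suc (suc k) l) k+l≡n
  = Reconstruction.reconstructed zero zero G H complete iso
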